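{- For any graphs $G$ and $H$, $\rho_e^o(G\circ H)\le \min\{\rho_e^o(G\boxtimes H),\ \rho_e^o(G\,\square\, H)\}$.
   Context: All graphs are finite and simple. A set $B\subseteq E(G)$ is an edge open packing set (EOP set) of $G$ if for any two distinct edges $e_1,e_2\in B$ there is no edge $e\in E(G)\setminus\{e_1,e_2\}$ joining an endvertex of $e_1$ to an endvertex of $e_2$ (that is, no edge $e$ such that $e_1,e,e_2$ form a path with middle edge $e$ or a triangle). Edges of $B$ may share an endvertex. The maximum cardinality of an EOP set is the EOP number $\rho_e^o(G)$. The following products of $G$ and $H$ all have vertex set $V(G)\times V(H)$. In the Cartesian product $G\,\square\,H$ two vertices are adjacent if they are adjacent in one coordinate and equal in the other. In the direct product $G\times H$ two vertices are adjacent if they are adjacent in both coordinates. The edge set of the strong product $G\boxtimes H$ is $E(G\,\square\,H)\cup E(G\times H)$. In the lexicographic product $G\circ H$, $(g,h)$ and $(g',h')$ are adjacent if either $gg'\in E(G)$, or $g=g'$ and $hh'\in E(H)$. -}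

module Defs where

open import Data.Fin.Base using (Fin)
import Data.Fin.Properties as Fin
open import Data.List.Base using (List; []; _∷_; length; lookup)
open import Data.List.Membership.Propositional using (_∈_)
open import Data.List.Membership.Propositional.Properties using (∈-lookup)
open import Data.List.Relation.Unary.All as All using (All; []; _∷_)
open import Data.List.Relation.Unary.AllPairs using (AllPairs; []; _∷_; allPairs?)
open import Data.Nat.Base using (ℕ; zero; suc; _*_; _≤_; s≤s⁻¹)
open import Data.Nat.Properties using (suc-injective; m≤n⇒m<n∨m≡n)
open import Data.Product.Base using (∃; ∃₂; ∃-syntax; _×_; _,_; proj₁; proj₂; uncurry)
open import Data.Product.Function.NonDependent.Propositional using (_×-↔_)
open import Data.Sum.Base using (_⊎_; inj₁; inj₂)
open import Function.Base using (case_of_)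
open import Function.Bundles using (_↔_; Inverse; Injection)
open import Function.Construct.Composition using (_↔-∘_)
open import Function.Construct.Symmetry using (↔-sym)
open import Function.Properties.Inverse using (↔⇒↣)
open import Relation.Binary.Core using (Rel)
open import Relation.Binary.Definitions using (Symmetric; Irreflexive; Decidable; DecidableEquality)
open import Relation.Binary.PropositionalEquality using (_≡_; refl; sym; cong; subst)
open import Relation.Nullary using (¬_; Dec; yes; no; contradiction)
open import Relation.Nullary.Decidable using (map′; ¬?; _×-dec_; _⊎-dec_; _→-dec_; via-injection)
open import Level using (0ℓ)

Finite : Set → Set
Finite A = ∃[ n ] (A ↔ Fin n)

_×-finite_ : ∀ {A B} → Finite A → Finite B → Finite (A × B)
(m , f) ×-finite (n , g) = m * n , (↔-sym Fin.*↔× ↔-∘ (f ×-↔ g))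

module _ {A : Set} (fin : Finite A) where
  open Inverse (proj₂ fin)

  finite-≟ : DecidableEquality A
  finite-≟ = via-injection (↔⇒↣ (proj₂ fin)) Fin._≟_

  finite-any? : {P : A → Set} → (∀ x → Dec (P x)) → Dec (∃ P)
  finite-any? {P} P? =
    map′ (λ (i , p) → from i , p)
         (λ (x , p) → to x , subst P (sym (strictlyInverseʳ x)) p)
         (Fin.any? λ i → P? (from i))

  finite-anyList? : {P : List A → Set} → (∀ xs → Dec (P xs)) →
                    ∀ k → Dec (∃[ xs ] (P xs × length xs ≡ k))
  finite-anyList? P? zero =
    map′ (λ p → [] , p , refl) (λ { ([] , p , _) → p }) (P? [])
  finite-anyList? P? (suc k) =
    map′ (λ (x , xs , p , eq) → x ∷ xs , p , cong suc eq)
         (λ { (x ∷ xs , p , eq) → x , xs , p , suc-injective eq })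
         (finite-any? λ x → finite-anyList? (λ xs → P? (x ∷ xs)) k)

record Graph : Set₁ where
  field
    V        : Set
    V-finite : Finite V
    _~_      : Rel V 0ℓ
    _~?_     : Decidable _~_
    ~-sym    : Symmetric _~_
    ~-irrefl : Irreflexive _≡_ _~_

  infix 4 _~_ _~?_ _≟_

  _≟_ : DecidableEquality V
  _≟_ = finite-≟ V-finite

infixl 7 _□_ _×ᵍ_ _⊠_ _∘_

_□_ : Graph → Graph → Graph
G □ H = record
  { V        = G.V × H.V
  ; V-finite = G.V-finite ×-finite H.V-finite
  ; _~_      = λ (g , h) (g′ , h′) → (g G.~ g′ × h ≡ h′) ⊎ (g ≡ g′ × h H.~ h′)
  ; _~?_     = λ (g , h) (g′ , h′) →
                 ((g G.~? g′) ×-dec (h H.≟ h′)) ⊎-dec ((g G.≟ g′) ×-dec (h H.~? h′))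
  ; ~-sym    = λ { (inj₁ (a , e)) → inj₁ (G.~-sym a , sym e)
                 ; (inj₂ (e , a)) → inj₂ (sym e , H.~-sym a) }
  ; ~-irrefl = λ { refl (inj₁ (a , _)) → G.~-irrefl refl a
                 ; refl (inj₂ (_ , a)) → H.~-irrefl refl a }
  }
  where module G = Graph G
        module H = Graph H

_×ᵍ_ : Graph → Graph → Graph
G ×ᵍ H = record
  { V        = G.V × H.V
  ; V-finite = G.V-finite ×-finite H.V-finite
  ; _~_      = λ (g , h) (g′ , h′) → g G.~ g′ × h H.~ h′
  ; _~?_     = λ (g , h) (g′ , h′) → (g G.~? g′) ×-dec (h H.~? h′)
  ; ~-sym    = λ (a , b) → G.~-sym a , H.~-sym b
  ; ~-irrefl = λ { refl (a , _) → G.~-irrefl refl a }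
  }
  where module G = Graph G
        module H = Graph H

_⊠_ : Graph → Graph → Graph
G ⊠ H = record
  { V        = Graph.V G × Graph.V H
  ; V-finite = Graph.V-finite G ×-finite Graph.V-finite H
  ; _~_      = λ x y → (x C.~ y) ⊎ (x D.~ y)
  ; _~?_     = λ x y → (x C.~? y) ⊎-dec (x D.~? y)
  ; ~-sym    = λ { (inj₁ a) → inj₁ (C.~-sym a) ; (inj₂ a) → inj₂ (D.~-sym a) }
  ; ~-irrefl = λ { e (inj₁ a) → C.~-irrefl e a ; e (inj₂ a) → D.~-irrefl e a }
  }
  where module C = Graph (G □ H)
        module D = Graph (G ×ᵍ H)

_∘_ : Graph → Graph → Graph
G ∘ H = record
  { V        = G.V × H.V
  ; V-finite = G.V-finite ×-finite H.V-finite
  ; _~_      = λ (g , h) (g′ , h′) → g G.~ g′ ⊎ (g ≡ g′ × h H.~ h′)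
  ; _~?_     = λ (g , h) (g′ , h′) → (g G.~? g′) ⊎-dec ((g G.≟ g′) ×-dec (h H.~? h′))
  ; ~-sym    = λ { (inj₁ a) → inj₁ (G.~-sym a)
                 ; (inj₂ (e , a)) → inj₂ (sym e , H.~-sym a) }
  ; ~-irrefl = λ { refl (inj₁ a) → G.~-irrefl refl a
                 ; refl (inj₂ (_ , a)) → H.~-irrefl refl a }
  }
  where module G = Graph G
        module H = Graph H

module _ (G : Graph) where
  open Graph G

  -- An edge is given by an ordered pair of adjacent vertices; pairs that
  -- differ only in orientation denote the same edge, so edges are
  -- compared with _≈_ rather than _≡_.
  Pair : Set
  Pair = V × V

  IsEdge : Pair → Set
  IsEdge (u , v) = u ~ v

  _≈_ : Rel Pair 0ℓ
  (u , v) ≈ (x , y) = (u ≡ x × v ≡ y) ⊎ (u ≡ y × v ≡ x)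

  _≉_ : Rel Pair 0ℓ
  e ≉ f = ¬ (e ≈ f)

  _EndvertexOf_ : V → Pair → Set
  x EndvertexOf (u , v) = x ≡ u ⊎ x ≡ v

  Joins : Pair → Pair → Pair → Set
  Joins e e₁ e₂ = ∃₂ λ x y → x EndvertexOf e₁ × y EndvertexOf e₂ × e ≈ (x , y)

  -- A set of edges is a list without repetition up to _≈_, so that its
  -- cardinality is the length of the list.
  record IsEOP (B : List Pair) : Set where
    field
      edges    : All IsEdge B
      distinct : AllPairs _≉_ B
      packing  : ∀ {e₁ e₂} → e₁ ∈ B → e₂ ∈ B → e₁ ≉ e₂ →
                 ¬ (∃[ e ] (IsEdge e × e ≉ e₁ × e ≉ e₂ × Joins e e₁ e₂))

  HasEOPOfSize : ℕ → Set
  HasEOPOfSize k = ∃[ B ] (IsEOP B × length B ≡ k)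

  IsEOPNumber : ℕ → Set
  IsEOPNumber k = HasEOPOfSize k × (∀ B → IsEOP B → length B ≤ k)

  private
    Pair-finite : Finite Pair
    Pair-finite = V-finite ×-finite V-finite

    _≈?_ : Decidable _≈_
    (u , v) ≈? (x , y) = ((u ≟ x) ×-dec (v ≟ y)) ⊎-dec ((u ≟ y) ×-dec (v ≟ x))

    endvertex? : ∀ x e → Dec (x EndvertexOf e)
    endvertex? x (u , v) = (x ≟ u) ⊎-dec (x ≟ v)

    joins? : ∀ e e₁ e₂ → Dec (Joins e e₁ e₂)
    joins? e e₁ e₂ = finite-any? V-finite λ x → finite-any? V-finite λ y →
      endvertex? x e₁ ×-dec (endvertex? y e₂ ×-dec (e ≈? (x , y)))

    isEOP? : ∀ B → Dec (IsEOP B)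
    isEOP? B = map′
      (λ (p , q , r) → record
        { edges = p ; distinct = q
        ; packing = λ i j → All.lookup (All.lookup r i) j })
      (λ E → let open IsEOP E in
        edges , distinct , All.tabulate λ i → All.tabulate λ j → packing i j)
      (All.all? (uncurry _~?_) B ×-dec
       (allPairs? (λ e f → ¬? (e ≈? f)) B ×-dec
        All.all? (λ e₁ → All.all? (λ e₂ →
          ¬? (e₁ ≈? e₂) →-dec
          ¬? (finite-any? Pair-finite λ e →
                uncurry _~?_ e ×-dec (¬? (e ≈? e₁) ×-dec
                (¬? (e ≈? e₂) ×-dec joins? e e₁ e₂)))) B) B))

    ≡⇒≈ : ∀ {e f} → e ≡ f → e ≈ f
    ≡⇒≈ refl = inj₁ (refl , refl)

    lookup-injective : ∀ {B} → AllPairs _≉_ B →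
                       ∀ {i j} → lookup B i ≡ lookup B j → i ≡ j
    lookup-injective (_  ∷ _)  {Fin.zero}  {Fin.zero}  _  = refl
    lookup-injective (ne ∷ _)  {Fin.zero}  {Fin.suc j} eq =
      contradiction (≡⇒≈ eq) (All.lookup ne (∈-lookup j))
    lookup-injective (ne ∷ _)  {Fin.suc i} {Fin.zero}  eq =
      contradiction (≡⇒≈ (sym eq)) (All.lookup ne (∈-lookup i))
    lookup-injective (_  ∷ ds) {Fin.suc i} {Fin.suc j} eq =
      cong Fin.suc (lookup-injective ds eq)

    size-bound : ∀ B → IsEOP B → length B ≤ proj₁ Pair-finite
    size-bound B E = Fin.injective⇒≤ {f = λ i → to (lookup B i)} λ eq →
      lookup-injective (IsEOP.distinct E) (injective eq)
      where open Injection (↔⇒↣ (proj₂ Pair-finite)) using (to; injective)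

    search : ∀ n → (∀ B → IsEOP B → length B ≤ n) → ∃ IsEOPNumber
    search zero    bound = zero , ([] , []-isEOP , refl) , bound
      where
      []-isEOP : IsEOP []
      []-isEOP = record { edges = [] ; distinct = [] ; packing = λ () }
    search (suc n) bound = case finite-anyList? Pair-finite isEOP? (suc n) of λ where
      (yes p) → suc n , p , bound
      (no ¬p) → search n λ B E → case m≤n⇒m<n∨m≡n (bound B E) of λ where
        (inj₁ lt) → s≤s⁻¹ lt
        (inj₂ eq) → contradiction (B , E , eq) ¬p

  eopNumber : ∃ IsEOPNumber
  eopNumber = search (proj₁ Pair-finite) size-bound

ρ : Graph → ℕ
ρ G = proj₁ (eopNumber G)

ρ-isEOPNumber : ∀ G → IsEOPNumber G (ρ G)
ρ-isEOPNumber G = proj₂ (eopNumber G)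

{-# OPTIONS --safe #-}

-- Split an EOP set B of G ∘ H into its vertical edges (constant in G) and the
-- remaining ones, which project to a set T of edges of G. Over an edge gg′ of T
-- the members of B form a star, whose leaves give an independent set of H
-- of the same size; let I be the largest of these independent sets. Replacing
-- the non-vertical edges by all (g , i)(g′ , i) with gg′ ∈ T and i ∈ I does not
-- decrease the size. The new edges lie in G □ H, and they form an EOP set
-- already in the larger graph G ⊠ H.

module Submission where

open import Defs
open import Data.Bool.Base using (true; false)
open import Data.List.Base using (List; []; _∷_; _++_; length; map; filter; deduplicate; cartesianProductWith)
open import Data.List.Membership.Propositional using (_∈_; find)
open import Data.List.Properties using (length-++; length-map)
import Data.List.Relation.Binary.Sublist.Propositional.Properties as Sublist
open import Data.List.Relation.Unary.All as All using (All; []; _∷_)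
import Data.List.Relation.Unary.All.Properties as All
open import Data.List.Relation.Unary.AllPairs as AllPairs using (AllPairs; []; _∷_)
import Data.List.Relation.Unary.AllPairs.Properties as AllPairs
open import Data.List.Relation.Unary.Any as Any using (Any; here; there)
import Data.List.Relation.Unary.Any.Properties as Any
import Data.List.Relation.Unary.Unique.DecSetoid.Properties as UniqueDec
import Data.List.Relation.Unary.Unique.Setoid.Properties as Unique
open import Data.Nat.Base using (ℕ; suc; _+_; _*_; _≤_; _⊓_; z≤n)
open import Data.Nat.Properties using (≤-reflexive; ≤-trans; ≤-total; +-suc; +-mono-≤; +-monoʳ-≤; ⊓-glb; module ≤-Reasoning)
open import Data.Product.Base using (∃-syntax; _×_; _,_; proj₁; proj₂; swap; uncurry)
open import Data.Sum.Base as Sum using (_⊎_; inj₁; inj₂; [_,_]′)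
open import Function.Base using (_$_)
open import Level using (0ℓ)
open import Relation.Binary.Bundles using (DecSetoid; Setoid)
open import Relation.Binary.Core using (Rel)
open import Relation.Binary.Definitions using (Symmetric; DecidableEquality)
open import Relation.Binary.Structures using (IsEquivalence)
open import Relation.Binary.PropositionalEquality using (_≡_; _≢_; refl; sym; trans; cong; cong₂; setoid)
open import Relation.Nullary using (¬_; Dec; yes; no; contradiction; does)
open import Relation.Nullary.Decidable using (¬?; _×-dec_; _⊎-dec_)
open import Relation.Unary using (Pred; Decidable)

-- Counting in lists and transport of pairwise relations

length-filter-¬ : ∀ {A : Set} {P : Pred A 0ℓ} (P? : Decidable P) xs →
                  length xs ≡ length (filter P? xs) + length (filter (λ x → ¬? (P? x)) xs)
length-filter-¬ P? [] = refl
length-filter-¬ P? (x ∷ xs) with does (P? x)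
... | true  = cong suc (length-filter-¬ P? xs)
... | false = trans (cong suc (length-filter-¬ P? xs)) (sym (+-suc _ _))

length-cartesianProductWith : ∀ {A B C : Set} (f : A → B → C) xs ys →
                              length (cartesianProductWith f xs ys) ≡ length xs * length ys
length-cartesianProductWith f []       ys = refl
length-cartesianProductWith f (x ∷ xs) ys =
  trans (length-++ (map (f x) ys))
        (cong₂ _+_ (length-map (f x) ys) (length-cartesianProductWith f xs ys))

length-reduce : ∀ {A B : Set} {P : Pred A 0ℓ} (f : ∀ {x} → P x → B) {xs} (pxs : All P xs) →
                length (All.reduce f pxs) ≡ length xs
length-reduce f []         = refl
length-reduce f (px ∷ pxs) = cong suc (length-reduce f pxs)

module _ {A B : Set} {P : Pred A 0ℓ} {S : Rel A 0ℓ} {R : Rel B 0ℓ} (f : ∀ {x} → P x → B)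
         (pres : ∀ {x y} (px : P x) (py : P y) → S x y → R (f px) (f py)) where

  -- Serves maps such as `heights`, whose value depends on a proof about the argument.
  allPairs-reduce : ∀ {xs} (pxs : All P xs) → AllPairs S xs → AllPairs R (All.reduce f pxs)
  allPairs-reduce []         []         = []
  allPairs-reduce (px ∷ pxs) (sx ∷ sxs) = all-reduce pxs sx ∷ allPairs-reduce pxs sxs
    where
    all-reduce : ∀ {ys} (pys : All P ys) → All (S _) ys → All (R (f px)) (All.reduce f pys)
    all-reduce []         []         = []
    all-reduce (py ∷ pys) (sy ∷ sys) = pres px py sy ∷ all-reduce pys sys

allPairs-lookup : ∀ {A : Set} {R : Rel A 0ℓ} → Symmetric R → ∀ {xs} → AllPairs R xs →
                  ∀ {x y} → x ∈ xs → y ∈ xs → x ≡ y ⊎ R x y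
allPairs-lookup s (_ ∷ _)  (here refl) (here refl) = inj₁ refl
allPairs-lookup s (r ∷ _)  (here refl) (there j)   = inj₂ (All.lookup r j)
allPairs-lookup s (r ∷ _)  (there i)   (here refl) = inj₂ (s (All.lookup r i))
allPairs-lookup s (_ ∷ rs) (there i)   (there j)   = allPairs-lookup s rs i j

module _ {A B : Set} {R : A → B → Set} (R? : ∀ x t → Dec (R x t)) where

  fibre : List A → B → List A
  fibre xs t = filter (λ x → R? x t) xs

  -- Induction on `ts`: discarding the fibre over the first `t` costs at most `m` entries, keeps the
  -- rest covered by the later ones, and can only shrink their fibres.
  length-≤-fibres : ∀ {m} ts xs → All (λ x → Any (R x) ts) xs →
                    All (λ t → length (fibre xs t) ≤ m) ts → length xs ≤ length ts * m
  length-≤-fibres []       []       _          _       = z≤n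
  length-≤-fibres []       (_ ∷ _)  (() ∷ _)   _
  length-≤-fibres {m} (t ∷ ts) xs cover (b ∷ bs) = begin
    length xs                          ≡⟨ length-filter-¬ (λ x → R? x t) xs ⟩
    length (fibre xs t) + length rest  ≤⟨ +-mono-≤ b (length-≤-fibres ts rest cover′ bs′) ⟩
    m + length ts * m                  ∎
    where
    open ≤-Reasoning
    outside? = λ x → ¬? (R? x t)
    rest = filter outside? xs

    cover′ : All (λ x → Any (R x) ts) rest
    cover′ = All.zipWith (λ { (¬r , here r) → contradiction r ¬r ; (_ , there a) → a })
                         (All.all-filter outside? xs , All.filter⁺ outside? cover)

    bs′ : All (λ t′ → length (fibre rest t′) ≤ m) ts
    bs′ = All.map (λ {t′} → ≤-trans (Sublist.length-mono-≤
            (Sublist.filter⁺ (λ x → R? x t′) (λ x → R? x t′) (λ { refl r → r })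
              (Sublist.filter-⊆ outside? xs)))) bs

longest : ∀ {A B : Set} {P : Pred (List A) 0ℓ} {n : B → ℕ} → P [] → ∀ {ts} →
          All (λ t → ∃[ xs ] (P xs × n t ≤ length xs)) ts →
          ∃[ xs ] (P xs × All (λ t → n t ≤ length xs) ts)
longest p[] [] = [] , p[] , []
longest p[] ((xs , p , b) ∷ bs) with longest p[] bs
... | ys , q , cs with ≤-total (length xs) (length ys)
...   | inj₁ le = ys , q , ≤-trans b le ∷ cs
...   | inj₂ ge = xs , p , b ∷ All.map (λ c → ≤-trans c ge) cs

-- Edges up to orientation

module _ {V : Set} where

  infix 4 _≋_ _≋̸_ _∈ₑ_

  -- Agrees with _≈_ G, but depends only on the vertex type, which the products
  -- of two graphs share.
  _≋_ : Rel (V × V) 0ℓ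
  (u , v) ≋ (x , y) = (u ≡ x × v ≡ y) ⊎ (u ≡ y × v ≡ x)

  _≋̸_ : Rel (V × V) 0ℓ
  e ≋̸ f = ¬ e ≋ f

  ≋-isEquivalence : IsEquivalence _≋_
  ≋-isEquivalence = record
    { refl  = inj₁ (refl , refl)
    ; sym   = λ { (inj₁ (refl , refl)) → inj₁ (refl , refl)
                ; (inj₂ (refl , refl)) → inj₂ (refl , refl) }
    ; trans = λ { (inj₁ (refl , refl)) q → q
                ; (inj₂ (refl , refl)) (inj₁ (refl , refl)) → inj₂ (refl , refl)
                ; (inj₂ (refl , refl)) (inj₂ (refl , refl)) → inj₁ (refl , refl) }
    }

  open IsEquivalence ≋-isEquivalence public using ()
    renaming (refl to ≋-refl; sym to ≋-sym; trans to ≋-trans)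

  reversed : ∀ {u v} → (u , v) ≋ (v , u)
  reversed = inj₂ (refl , refl)

  _∈ₑ_ : V × V → List (V × V) → Set
  e ∈ₑ B = Any (e ≋_) B

  ∈⇒∈ₑ : ∀ {e B} → e ∈ B → e ∈ₑ B
  ∈⇒∈ₑ = Any.map λ { refl → ≋-refl }

  ∈ₑ-resp-≋ : ∀ {e f B} → e ≋ f → f ∈ₑ B → e ∈ₑ B
  ∈ₑ-resp-≋ e≋f = Any.map (≋-trans e≋f)

  ∈ₑ-swap : ∀ {u v B} → (u , v) ∈ₑ B → (v , u) ∈ₑ B
  ∈ₑ-swap = ∈ₑ-resp-≋ reversed

edgeSetoid : Set → Setoid 0ℓ 0ℓ
edgeSetoid V = record { isEquivalence = ≋-isEquivalence {V} }

edgeDecSetoid : {V : Set} → DecidableEquality V → DecSetoid 0ℓ 0ℓ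
edgeDecSetoid {V} _≟_ = record
  { isDecEquivalence = record
    { isEquivalence = ≋-isEquivalence {V}
    ; _≟_ = λ (u , v) (x , y) → ((u ≟ x) ×-dec (v ≟ y)) ⊎-dec ((u ≟ y) ×-dec (v ≟ x))
    }
  }

-- The packing condition for oriented edges

module _ (G : Graph) where
  open Graph G

  isEdge-resp-≋ : ∀ {e f} → e ≋ f → IsEdge G f → IsEdge G e
  isEdge-resp-≋ (inj₁ (refl , refl)) a = a
  isEdge-resp-≋ (inj₂ (refl , refl)) a = ~-sym a

  -- The packing condition in terms of oriented edges: an edge joining the
  -- first endvertices u and x can only be one of the two given edges.
  Spaced : List (Pair G) → Set
  Spaced B = ∀ {u v x y} → (u , v) ∈ₑ B → (x , y) ∈ₑ B → (u , v) ≋̸ (x , y) →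
             u ~ x → x ≡ v ⊎ u ≡ y

  -- If both conclusions fail, `(u , x)` is a forbidden joining edge: the remaining ways for it to
  -- coincide with a given edge would make `u ~ x` a loop.
  isEOP⇒spaced : ∀ {B} → IsEOP G B → Spaced B
  isEOP⇒spaced E {u} {v} {x} {y} uv∈B xy∈B uv≉xy u~x with x ≟ v | u ≟ y
  ... | yes x≡v | _       = inj₁ x≡v
  ... | no  _   | yes u≡y = inj₂ u≡y
  ... | no  x≢v | no u≢y with find uv∈B | find xy∈B
  ...   | e₁ , e₁∈B , uv≋e₁ | e₂ , e₂∈B , xy≋e₂ = contradiction
    ( (u , x) , u~x
    , (λ p → [ (λ (_ , x≡v) → x≢v x≡v) , (λ (_ , x≡u) → ~-irrefl (sym x≡u) u~x) ]′
               (≋-trans p (≋-sym uv≋e₁)))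
    , (λ p → [ (λ (u≡x , _) → ~-irrefl u≡x u~x) , (λ (u≡y , _) → u≢y u≡y) ]′
               (≋-trans p (≋-sym xy≋e₂)))
    , u , x , endvertex uv≋e₁ , endvertex xy≋e₂ , ≋-refl )
    (IsEOP.packing E e₁∈B e₂∈B λ q → uv≉xy (≋-trans uv≋e₁ (≋-trans q (≋-sym xy≋e₂))))
    where
    endvertex : ∀ {a b e} → (a , b) ≋ e → _EndvertexOf_ G a e
    endvertex = Sum.map proj₁ proj₁

  isEOP⇒isEdge : ∀ {B e} → IsEOP G B → e ∈ₑ B → IsEdge G e
  isEOP⇒isEdge E e∈B with find e∈B
  ... | f , f∈B , e≋f = isEdge-resp-≋ e≋f (All.lookup (IsEOP.edges E) f∈B)

  -- Orient both edges to start at the ends of the joining edge; either outcome of `Spaced` then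
  -- identifies the joining edge with one of them.
  spaced⇒isEOP : ∀ {B} → All (IsEdge G) B → AllPairs _≋̸_ B → Spaced B → IsEOP G B
  spaced⇒isEOP {B} edges distinct spaced = record
    { edges = edges ; distinct = distinct ; packing = packing }
    where
    orient : ∀ {x e} → _EndvertexOf_ G x e → ∃[ x′ ] (x , x′) ≋ e
    orient (inj₁ x≡u) = _ , inj₁ (x≡u , refl)
    orient (inj₂ x≡v) = _ , inj₂ (x≡v , refl)

    packing : ∀ {e₁ e₂} → e₁ ∈ B → e₂ ∈ B → e₁ ≋̸ e₂ →
              ¬ (∃[ e ] (IsEdge G e × e ≋̸ e₁ × e ≋̸ e₂ × Joins G e e₁ e₂))
    packing {e₁} {e₂} e₁∈B e₂∈B e₁≉e₂ (e , a , e≉e₁ , e≉e₂ , x , y , x∈e₁ , y∈e₂ , e≋xy)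
      with orient {e = e₁} x∈e₁ | orient {e = e₂} y∈e₂
    ... | x′ , xx′≋e₁ | y′ , yy′≋e₂
      with spaced (∈ₑ-resp-≋ xx′≋e₁ (∈⇒∈ₑ e₁∈B)) (∈ₑ-resp-≋ yy′≋e₂ (∈⇒∈ₑ e₂∈B))
                  (λ q → e₁≉e₂ (≋-trans (≋-sym xx′≋e₁) (≋-trans q yy′≋e₂)))
                  (isEdge-resp-≋ (≋-sym e≋xy) a)
    ...   | inj₁ refl = e≉e₁ (≋-trans e≋xy xx′≋e₁)
    ...   | inj₂ refl = e≉e₂ (≋-trans e≋xy (≋-trans reversed yy′≋e₂))

-- Independent sets and stars

module _ (H : Graph) where
  open Graph H

  Independent : List V → Set
  Independent = AllPairs λ i j → i ≢ j × ¬ i ~ j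

  independent⇒≁ : ∀ {I i j} → Independent I → i ∈ I → j ∈ I → ¬ i ~ j
  independent⇒≁ ind i∈I j∈I with allPairs-lookup (λ (p , q) → (λ e → p (sym e)) , λ a → q (~-sym a)) ind i∈I j∈I
  ... | inj₁ i≡j       = ~-irrefl i≡j
  ... | inj₂ (_ , i≁j) = i≁j

  -- The relation between the second coordinates of two members of an EOP set
  -- of a lexicographic product that lie over the same edge of the first factor.
  StarPair : Rel (V × V) 0ℓ
  StarPair (a , b) (a′ , b′) = (a ≡ a′ × b ≢ b′ × ¬ b ~ b′) ⊎ (b ≡ b′ × a ≢ a′ × ¬ a ~ a′)

  commonFirst⇒independent : ∀ {a ps} → All (λ p → a ≡ proj₁ p) ps → AllPairs StarPair ps →
                            Independent (map proj₂ ps)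
  commonFirst⇒independent []             []       = []
  commonFirst⇒independent (refl ∷ firsts) (s ∷ ss) =
    All.map⁺ (All.zipWith (λ { (_ , inj₁ (_ , r)) → r
                             ; (refl , inj₂ (_ , a≢a , _)) → contradiction refl a≢a }) (firsts , s))
    ∷ commonFirst⇒independent firsts ss

  starPair-swap : ∀ {p q} → StarPair p q → StarPair (swap p) (swap q)
  starPair-swap = Sum.swap

  -- A further pair that misses the common first coordinate would share its second coordinate with
  -- both `p` and `q`, which `StarPair` excludes.
  commonFirst : ∀ {p q ps} → proj₁ p ≡ proj₁ q → AllPairs StarPair (p ∷ q ∷ ps) →
                All (λ r → proj₁ p ≡ proj₁ r) (p ∷ q ∷ ps)
  commonFirst refl ((pq ∷ ps) ∷ qs ∷ _) = refl ∷ refl ∷ All.zipWith (common pq) (ps , qs)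
    where
    common : ∀ {a b b′ r} → StarPair (a , b) (a , b′) → StarPair (a , b) r × StarPair (a , b′) r → a ≡ proj₁ r
    common _ (inj₁ (a≡ , _) , _) = a≡
    common _ (inj₂ _ , inj₁ (a≡ , _)) = a≡
    common (inj₁ (_ , b≢b′ , _)) (inj₂ (b≡ , _) , inj₂ (b′≡ , _)) = contradiction (trans b≡ (sym b′≡)) b≢b′
    common (inj₂ (_ , a≢a , _)) (inj₂ _ , inj₂ _) = contradiction refl a≢a

  -- The first two pairs decide which coordinate is the centre of the star; the other coordinates
  -- are its leaves.
  starPairs⇒independent : ∀ {ps} → AllPairs StarPair ps →
                          ∃[ I ] (Independent I × length ps ≡ length I)
  starPairs⇒independent [] = [] , [] , refl
  -- A single pair has no distinguished centre, and either coordinate would do.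
  starPairs⇒independent {p ∷ []} _ = proj₁ p ∷ [] , [] ∷ [] , refl
  starPairs⇒independent {ps@(_ ∷ _ ∷ _)} s@((inj₁ (a≡a′ , _) ∷ _) ∷ _) =
    map proj₂ ps , commonFirst⇒independent (commonFirst a≡a′ s) s , sym (length-map proj₂ ps)
  starPairs⇒independent {ps@(_ ∷ _ ∷ _)} s@((inj₂ (b≡b′ , _) ∷ _) ∷ _) =
    map proj₂ sps , commonFirst⇒independent (commonFirst b≡b′ ss) ss
    , trans (sym (length-map swap ps)) (sym (length-map proj₂ sps))
    where
    sps = map swap ps
    ss : AllPairs StarPair sps
    ss = AllPairs.map⁺ (AllPairs.map (λ {p} {q} → starPair-swap {p} {q}) s)

-- Replacing the non-vertical edges of an EOP set

module Replacement (G H : Graph) {B : List (Pair (G ∘ H))} (E : IsEOP (G ∘ H) B) where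

  private
    module G = Graph G
    module H = Graph H
    module GE = DecSetoid (edgeDecSetoid G._≟_)

    Edge : Set
    Edge = (G.V × H.V) × (G.V × H.V)

  spaced : Spaced (G ∘ H) B
  spaced = isEOP⇒spaced (G ∘ H) E

  edge : ∀ {e} → e ∈ₑ B → IsEdge (G ∘ H) e
  edge = isEOP⇒isEdge (G ∘ H) E

  project : Edge → G.V × G.V
  project ((g , _) , (g′ , _)) = g , g′

  lift : G.V × G.V → H.V × H.V → Edge
  lift (g , g′) (a , b) = (g , a) , (g′ , b)

  lifts-starPair : ∀ {t p q} → IsEdge G t → lift t p ∈ₑ B → lift t q ∈ₑ B →
                   lift t p ≋̸ lift t q → StarPair H p q
  lifts-starPair {p = a , b} {q = a′ , b′} g~g′ p∈B q∈B p≉q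
    -- Reversing the second edge makes the cross edge from `(g , a)` to `(g′ , b′)` the joining
    -- edge. It must be one of the two given edges, so these share an endvertex. A vertical edge
    -- between their other ends could not coincide with either.
    with spaced p∈B (∈ₑ-swap q∈B) (λ r → p≉q (≋-trans r reversed)) (inj₁ g~g′)
  ... | inj₁ refl = inj₂ (refl , (λ { refl → p≉q ≋-refl }) , λ a~a′ →
    [ (λ { refl → G.~-irrefl refl g~g′ }) , (λ { refl → G.~-irrefl refl g~g′ }) ]′
      (spaced p∈B q∈B p≉q (inj₂ (refl , a~a′))))
  ... | inj₂ refl = inj₁ (refl , (λ { refl → p≉q ≋-refl }) , λ b~b′ →
    [ (λ { refl → G.~-irrefl refl g~g′ }) , (λ { refl → G.~-irrefl refl g~g′ }) ]′
      (spaced (∈ₑ-swap p∈B) (∈ₑ-swap q∈B)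
        (λ r → p≉q (≋-trans reversed (≋-trans r reversed))) (inj₂ (refl , b~b′))))

  -- The second coordinates are ordered by the orientation of `t`, so that lifting `t` recovers `e`
  -- up to orientation.
  heights : ∀ {t} e → project e ≋ t → H.V × H.V
  heights ((_ , h) , (_ , h′)) (inj₁ _) = h , h′
  heights ((_ , h) , (_ , h′)) (inj₂ _) = h′ , h

  lift-heights : ∀ {t} e (p : project e ≋ t) → e ≋ lift t (heights e p)
  lift-heights e (inj₁ (refl , refl)) = inj₁ (refl , refl)
  lift-heights e (inj₂ (refl , refl)) = inj₂ (refl , refl)

  over⇒independent : ∀ {t xs} → IsEdge G t → AllPairs _≋̸_ xs →
                     All (_∈ₑ B) xs → All (λ e → project e ≋ t) xs →
                     ∃[ I ] (Independent H I × length xs ≤ length I)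
  over⇒independent {t} {xs} t-edge distinct xs∈B over =
    let I , ind , eq = starPairs⇒independent H (allPairs-reduce height starPair both distinct)
    in I , ind , ≤-reflexive (trans (sym (length-reduce height both)) eq)
    where
    Over : Edge → Set
    Over e = e ∈ₑ B × project e ≋ t

    both : All Over xs
    both = All.zip (xs∈B , over)

    height : ∀ {e} → Over e → H.V × H.V
    height {e} (_ , p) = heights e p

    starPair : ∀ {e f} (p : Over e) (q : Over f) → e ≋̸ f →
               StarPair H (height {e} p) (height {f} q)
    starPair {e} {f} (e∈B , p) (f∈B , q) e≉f = lifts-starPair t-edge
      (∈ₑ-resp-≋ (≋-sym (lift-heights e p)) e∈B) (∈ₑ-resp-≋ (≋-sym (lift-heights f q)) f∈B)
      (λ r → e≉f (≋-trans (lift-heights e p) (≋-trans r (≋-sym (lift-heights f q)))))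

  -- If gg₁ were an edge, the edges from (g₁ , k) to both ends of the vertical
  -- edge would have to coincide with the edge (g₁ , k)(g₂ , l).
  vertical-≁ : ∀ {g h h′ g₁ g₂ k l} → ((g , h) , (g , h′)) ∈ₑ B →
               ((g₁ , k) , (g₂ , l)) ∈ₑ B → g₁ G.~ g₂ → ¬ g G.~ g₁
  vertical-≁ {g} {h} {h′} {g₁} {g₂} {k} {l} v∈B e∈B g₁~g₂ g~g₁ =
    ~-irrefl (trans (meets v∈B) (sym (meets (∈ₑ-swap v∈B)))) (edge v∈B)
    where
    open Graph (G ∘ H) using (~-irrefl)
    meets : ∀ {a b} → ((g , a) , (g , b)) ∈ₑ B → (g , a) ≡ (g₂ , l)
    meets ab∈B with spaced ab∈B e∈B
                      (λ { (inj₁ (refl , refl)) → G.~-irrefl refl g₁~g₂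
                         ; (inj₂ (refl , refl)) → G.~-irrefl refl g₁~g₂ })
                      (inj₁ g~g₁)
    ... | inj₁ refl = contradiction g~g₁ (G.~-irrefl refl)
    ... | inj₂ eq   = eq

  -- If `g` were `g₁`, it would be adjacent to `g₂`, and `vertical-≁` applies to the reversed edge.
  vertical-≢ : ∀ {g h h′ g₁ g₂ k l} → ((g , h) , (g , h′)) ∈ₑ B →
               ((g₁ , k) , (g₂ , l)) ∈ₑ B → g₁ G.~ g₂ → g ≢ g₁
  vertical-≢ v∈B e∈B g₁~g₂ refl = vertical-≁ v∈B (∈ₑ-swap e∈B) (G.~-sym g₁~g₂) g₁~g₂

  ⊠⇒∘ : ∀ {x y} → Graph._~_ (G ⊠ H) x y → Graph._~_ (G ∘ H) x y
  ⊠⇒∘ (inj₁ (inj₁ (g~g′ , _))) = inj₁ g~g′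
  ⊠⇒∘ (inj₁ (inj₂ e))          = inj₂ e
  ⊠⇒∘ (inj₂ (g~g′ , _))        = inj₁ g~g′

  -- Spacing of vertical and levelled edges

  module _ {I : List H.V} (I-independent : Independent H I) where

    -- A levelled edge remembers some member of `B` over the same edge of `G`; the heights `k` and
    -- `l` of that member are unrelated to `i`.
    data Shape : Edge → Set where
      vertical : ∀ {g h h′} → ((g , h) , (g , h′)) ∈ₑ B → Shape ((g , h) , (g , h′))
      levelled : ∀ {g g′ i k l} → i ∈ I → g G.~ g′ → ((g , k) , (g′ , l)) ∈ₑ B →
                 Shape ((g , i) , (g′ , i))

    shape-resp-≋ : ∀ {e f} → e ≋ f → Shape f → Shape e
    shape-resp-≋ (inj₁ (refl , refl)) s = s
    shape-resp-≋ (inj₂ (refl , refl)) (vertical e∈B)          = vertical (∈ₑ-swap e∈B)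
    shape-resp-≋ (inj₂ (refl , refl)) (levelled i∈I g~g′ e∈B) = levelled i∈I (G.~-sym g~g′) (∈ₑ-swap e∈B)

    shape⇒isEdge-□ : ∀ {e} → Shape e → IsEdge (G □ H) e
    shape⇒isEdge-□ (vertical e∈B) with edge e∈B
    ... | inj₁ g~g        = contradiction g~g (G.~-irrefl refl)
    ... | inj₂ (_ , h~h′) = inj₂ (refl , h~h′)
    shape⇒isEdge-□ (levelled _ g~g′ _) = inj₁ (g~g′ , refl)

    -- Two vertical edges inherit spacing from `B`, and a vertical edge has no joining edge to a
    -- levelled one. Between levelled edges, a joining edge that changes height would join two
    -- members of the independent set `I`.
    shapes-spaced : ∀ {u v x y} → Shape (u , v) → Shape (x , y) → (u , v) ≋̸ (x , y) →
                    Graph._~_ (G ⊠ H) u x → x ≡ v ⊎ u ≡ y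
    shapes-spaced (vertical p) (vertical q) ne u~x = spaced p q ne (⊠⇒∘ u~x)
    shapes-spaced (vertical p) (levelled _ a q) _ u~x with ⊠⇒∘ u~x
    ... | inj₁ b        = contradiction b (vertical-≁ p q a)
    ... | inj₂ (eq , _) = contradiction eq (vertical-≢ p q a)
    shapes-spaced (levelled _ a p) (vertical q) _ u~x with ⊠⇒∘ u~x
    ... | inj₁ b        = contradiction (G.~-sym b) (vertical-≁ q p a)
    ... | inj₂ (eq , _) = contradiction (sym eq) (vertical-≢ q p a)
    shapes-spaced (levelled i∈I _ _) (levelled j∈I _ _) _ (inj₁ (inj₂ (_ , i~j))) =
      contradiction i~j (independent⇒≁ H I-independent i∈I j∈I)
    shapes-spaced (levelled i∈I _ _) (levelled j∈I _ _) _ (inj₂ (_ , i~j)) =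
      contradiction i~j (independent⇒≁ H I-independent i∈I j∈I)
    -- Adjacency in `G` alone suffices in `G ∘ H`, so the remembered members of `B` are joined as
    -- well, whatever their heights. Their common endvertex fixes the first coordinates, and the
    -- heights here already agree.
    shapes-spaced (levelled _ _ p) (levelled _ _ q) ne (inj₁ (inj₁ (c , refl)))
      with spaced p q (λ { (inj₁ (refl , refl)) → ne (inj₁ (refl , refl))
                         ; (inj₂ (refl , refl)) → ne (inj₂ (refl , refl)) }) (inj₁ c)
    ... | inj₁ refl = inj₁ refl
    ... | inj₂ refl = inj₂ refl

  -- Construction and size of the replacement

  Vertical : Edge → Set
  Vertical e = uncurry _≡_ (project e)

  vertical? : Decidable Vertical
  vertical? e = uncurry G._≟_ (project e)

  verticals nonverticals : List Edge
  verticals    = filter vertical? B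
  nonverticals = filter (λ e → ¬? (vertical? e)) B

  T : List (G.V × G.V)
  T = deduplicate GE._≟_ (map project nonverticals)

  B⊆B : All (_∈ₑ B) B
  B⊆B = All.tabulate ∈⇒∈ₑ

  nonverticals⊆B : All (_∈ₑ B) nonverticals
  nonverticals⊆B = All.filter⁺ (λ e → ¬? (vertical? e)) B⊆B

  -- A non-vertical edge of `G ∘ H` can only come from an edge of `G`. The lift into `B` is the
  -- witness that `levelled` requires.
  T-lifts : All (λ t → IsEdge G t × ∃[ p ] lift t p ∈ₑ B) T
  T-lifts = All.deduplicate⁺ GE._≟_ $ All.map⁺ $ All.zipWith lifted
    (nonverticals⊆B , All.all-filter (λ e → ¬? (vertical? e)) B)
    where
    lifted : ∀ {e} → e ∈ₑ B × ¬ Vertical e →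
             IsEdge G (project e) × ∃[ p ] lift (project e) p ∈ₑ B
    lifted (e∈B , nv) with edge e∈B
    ... | inj₁ g~g′      = g~g′ , _ , e∈B
    ... | inj₂ (g≡g′ , _) = contradiction g≡g′ nv

  over? : ∀ e t → Dec (project e ≋ t)
  over? e t = project e GE.≟ t

  T-covers : All (λ e → Any (λ t → project e ≋ t) T) nonverticals
  T-covers = All.tabulate λ e∈ → Any.deduplicate⁺ GE._≟_
    (λ r p → ≋-trans p (≋-sym r))
    (Any.map⁺ (Any.map (λ { refl → ≋-refl }) e∈))

  independents : ∃[ I ] (Independent H I × All (λ t → length (fibre over? nonverticals t) ≤ length I) T)
  -- The empty list is the choice of `I` when `T` is empty.
  independents = longest {n = λ t → length (fibre over? nonverticals t)} [] $
    All.map (λ {t} (t-edge , _) → over⇒independent t-edge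
      (AllPairs.filter⁺ (λ e → over? e t) (AllPairs.filter⁺ (λ e → ¬? (vertical? e)) (IsEOP.distinct E)))
      (All.filter⁺ (λ e → over? e t) nonverticals⊆B)
      (All.all-filter (λ e → over? e t) nonverticals)) T-lifts

  I : List H.V
  I = proj₁ independents

  I-independent : Independent H I
  I-independent = proj₁ (proj₂ independents)

  level : G.V × G.V → H.V → Edge
  level t i = lift t (i , i)

  replacement : List Edge
  replacement = verticals ++ cartesianProductWith level T I

  length-replacement : length B ≤ length replacement
  length-replacement = begin
    length B                                ≡⟨ length-filter-¬ vertical? B ⟩
    length verticals + length nonverticals  ≤⟨ +-monoʳ-≤ (length verticals)
      (length-≤-fibres over? T nonverticals T-covers (proj₂ (proj₂ independents))) ⟩
    length verticals + length T * length I  ≡⟨ cong (length verticals +_) (length-cartesianProductWith level T I) ⟨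
    length verticals + length (cartesianProductWith level T I) ≡⟨ length-++ verticals ⟨
    length replacement                      ∎
    where open ≤-Reasoning

  -- The replacement is an EOP set in both products

  vertical-shapes : All (Shape I-independent) verticals
  vertical-shapes = All.zipWith (λ { (refl , e∈B) → vertical e∈B })
    (All.all-filter vertical? B , All.filter⁺ vertical? B⊆B)

  levelled-shapes : All (Shape I-independent) (cartesianProductWith level T I)
  levelled-shapes = All.cartesianProductWith⁺ (setoid _) (setoid _) level T I λ t∈T i∈I →
    let t-edge , _ , e∈B = All.lookup T-lifts t∈T in levelled i∈I t-edge e∈B

  shapes : All (Shape I-independent) replacement
  shapes = All.++⁺ vertical-shapes levelled-shapes

  shape : ∀ {e} → e ∈ₑ replacement → Shape I-independent e
  shape e∈ with find e∈
  ... | f , f∈ , e≋f = shape-resp-≋ I-independent e≋f (All.lookup shapes f∈)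

  replacement-edges : All (IsEdge (G □ H)) replacement
  replacement-edges = All.map (shape⇒isEdge-□ I-independent) shapes

  -- `level` is injective up to orientation, and neither `T` nor `I` has repetitions. A vertical
  -- edge differs from a levelled one because the latter projects to an edge of `G`, which is not a
  -- loop.
  replacement-distinct : AllPairs _≋̸_ replacement
  replacement-distinct = AllPairs.++⁺
    (AllPairs.filter⁺ vertical? (IsEOP.distinct E))
    (Unique.cartesianProductWith⁺ (edgeSetoid G.V) (setoid H.V) (edgeSetoid (G.V × H.V)) level
      (λ { (inj₁ (refl , refl)) → inj₁ (refl , refl) , refl
         ; (inj₂ (refl , refl)) → inj₂ (refl , refl) , refl })
      (UniqueDec.deduplicate-! (edgeDecSetoid G._≟_) (map project nonverticals))
      (AllPairs.map proj₁ I-independent))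
    (All.map (λ v → All.map (λ s → v≉l v s) T-levels) (All.all-filter vertical? B))
    where
    T-levels : All (λ e → IsEdge G (project e)) (cartesianProductWith level T I)
    T-levels = All.cartesianProductWith⁺ (setoid _) (setoid _) level T I λ t∈T _ →
      proj₁ (All.lookup T-lifts t∈T)

    v≉l : ∀ {e f} → Vertical e → IsEdge G (project f) → e ≋̸ f
    v≉l refl a (inj₁ (refl , refl)) = G.~-irrefl refl a
    v≉l refl a (inj₂ (refl , refl)) = G.~-irrefl refl a

  replacement-spaced : Spaced (G ⊠ H) replacement
  replacement-spaced p q = shapes-spaced I-independent (shape p) (shape q)

  replacement-isEOP-⊠ : IsEOP (G ⊠ H) replacement
  replacement-isEOP-⊠ = spaced⇒isEOP (G ⊠ H)
    (All.map inj₁ replacement-edges) replacement-distinct replacement-spaced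

  replacement-isEOP-□ : IsEOP (G □ H) replacement
  replacement-isEOP-□ = spaced⇒isEOP (G □ H)
    -- Every edge of `G □ H` is an edge of `G ⊠ H`, so spacing carries over to the smaller graph.
    replacement-edges replacement-distinct λ p q ne a → replacement-spaced p q ne (inj₁ a)

-- Comparison of the EOP numbers

-- Uses only the specification of the EOP number, independently of how `ρ` is computed.
eopSize-≤ : ∀ {G H k m n} → HasEOPOfSize (G ∘ H) k → IsEOPNumber (G ⊠ H) m →
            IsEOPNumber (G □ H) n → k ≤ m ⊓ n
eopSize-≤ {G} {H} (_ , E , refl) (_ , max-⊠) (_ , max-□) = ⊓-glb
  (≤-trans length-replacement (max-⊠ replacement replacement-isEOP-⊠))
  (≤-trans length-replacement (max-□ replacement replacement-isEOP-□))
  where open Replacement G H E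

proposition5p2 : (G H : Graph) → ρ (G ∘ H) ≤ ρ (G ⊠ H) ⊓ ρ (G □ H)
proposition5p2 G H = eopSize-≤ {G} {H}
  (proj₁ (ρ-isEOPNumber (G ∘ H))) (ρ-isEOPNumber (G ⊠ H)) (ρ-isEOPNumber (G □ H))
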